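{- Let $E_9$ be the formula (the last expansion along the abbreviation scheme $U_0$) defined in the context, let $E_9(x_{19};x_{18})$ be the word obtained from $E_9$ by simultaneously replacing every occurrence of $x$ by $x_{19}$ and every occurrence of $y$ by $x_{18}$, and let $$\varphi\equiv(\forall x_{18}\neg(\exists x_{19}\,E_9(x_{19};x_{18}))),$$ a word over the alphabet $\mathcal{A}=\{x_i : i\in\mathbb{N}\}\cup\{\in,=,\neg,\to,\leftrightarrow,\wedge,\vee,\exists,\forall,(,)\}$. Then $|\varphi|=494$, $|\varphi|_{\neg}=1$, and for every digraph $D$: $D\models\varphi$ if and only if Cantor's theorem holds in $D$.
   Context: $\mathbb{N}=\{1,2,\dots\}$. For a word $u$, $|u|$ is its length (number of letters) and $|u|_{\neg}$ is the number of occurrences of the letter $\neg$ in it. FORMULAS. Set variables are $x_1,x_2,\dots$ and "new variables" $\mathcal{V}=\{x,y,z,a,b,c,y_1,y_2,\dots\}$; every variable and every symbol $\in,=,\neg,\to,\leftrightarrow,\wedge,\vee,\exists,\forall,(,)$ is a single letter. Formulas are the words built from atomic formulas $(\alpha\in\alpha')$ and $(\alpha=\alpha')$ (length 5; $\alpha,\alpha'$ variables) by: $\neg u$, $(u\to v)$, $(u\leftrightarrow v)$, $(u\wedge v)$, $(u\vee v)$, $(\exists x_k u)$, $(\forall x_k u)$. ZF formulas are the formulas without new variables. A sentence is a formula without free occurrences of variables. DIGRAPHS AND SATISFACTION. A digraph is $D=\langle V,E\rangle$ with $V$ a nonempty set and $E\subseteq V\times V$; $uEv$ means $\langle u,v\rangle\in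 E$. $D\models_f u$, for $f$ a map from the variables to $V$, is the usual first-order satisfaction, with $(\alpha\in\alpha')$ read as $f(\alpha)Ef(\alpha')$, $(\alpha=\alpha')$ as $f(\alpha)=f(\alpha')$, and quantifiers ranging over $V$. For sentences this does not depend on $f$ and one writes $D\models u$. THE FORMULA $E_9$. The scheme $U_0=\langle\Phi_1,\dots,\Phi_9\rangle$ consists of the shortcuts (predicate $\equiv$ right-hand side): $\Phi_1$: $\mathrm{SUS}(x;y)\equiv(\forall x_1((x_1\in x)\to(x_1\in y)))$; $\Phi_2$: $\mathrm{SI}(x;y)\equiv(\forall x_2((x_2\in x)\leftrightarrow(x_2=y)))$; $\Phi_3$: $\mathrm{SIN}(x;y)\equiv(\forall x_3(\mathrm{SI}(x_3;y)\leftrightarrow(x_3=x)))$; $\Phi_4$: $\mathrm{DO}(x;y;z)\equiv(\forall x_4((x_4\in x)\leftrightarrow((x_4=y)\vee(x_4=z))))$; $\Phi_5$: $\mathrm{DOU}(x;y;z)\equiv(\forall x_5(\mathrm{DO}(x_5;y;z)\leftrightarrow(x_5=x)))$; $\Phi_6$: $\mathrm{OPA}(x;y;z)\equiv(\exists x_6(\exists x_7(\mathrm{DOU}(x;x_6;x_7)\wedge(\mathrm{SIN}(x_6;y)\wedge\mathrm{DOU}(x_7;y;z)))))$; $\Phi_7$: $\mathrm{REL}(x;y)\equiv(\forall x_8((x_8\in x)\to(\exists x_9(\exists x_{10}(\mathrm{OPA}(x_8;x_9;x_{10})\wedge((x_9\in y)\wedge\mathrm{SUS}(x_{10};y)))))))$;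 $\Phi_8$: $\mathrm{FUN}(x;y)\equiv(\mathrm{REL}(x;y)\wedge(\forall x_{11}((x_{11}\in y)\to(\exists x_{12}(\forall x_{13}((x_{13}=x_{12})\leftrightarrow((x_{13}\in x)\wedge(\exists x_{14}\mathrm{OPA}(x_{13};x_{11};x_{14})))))))))$; $\Phi_9$: $\mathrm{SUR}(x;y)\equiv(\mathrm{FUN}(x;y)\wedge(\forall x_{15}(\mathrm{SUS}(x_{15};y)\to(\exists x_{16}(\exists x_{17}((x_{16}\in x)\wedge\mathrm{OPA}(x_{16};x_{17};x_{15})))))))$. The expansions $E_1,\dots,E_9$ are predicate-free formulas defined recursively: $E_i$ is obtained from the right-hand side of $\Phi_i$ by replacing each predicate atom $q(\alpha_1;\dots;\alpha_m)$, where $q$ is the predicate of $\Phi_k$, $k<i$, with left-hand side $q(\beta_1;\dots;\beta_m)$, by the word obtained from $E_k$ by simultaneously replacing all occurrences of $\beta_1,\dots,\beta_m$ by $\alpha_1,\dots,\alpha_m$. CANTOR'S THEOREM IN A DIGRAPH. Let $D=\langle V,E\rangle$ be a digraph and $N(u)=\{v\in V: vEu\}$; elements of $N(u)$ are the $D$-elements of $u$. For vertices: $u$ is a $D$-subset of $v$ ($u\subset_D v$) if $N(u)\subseteq N(v)$; $u$ is the singleton $\{v\}_D$ if $u$ is the only vertex with $N(u)=\{v\}$; $u$ is the doubleton $\{v,w\}_D$ if $u$ is the only vertex with $N(u)=\{v,w\}$; $u$ is an ordered pair $\langle v,w\rangle_D$ if $u=\{\{v\}_D,\{v,w\}_D\}_D$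 (i.e. there are vertices $s,t$ such that $s$ is the singleton $\{v\}_D$, $t$ is the doubleton $\{v,w\}_D$ and $u$ is the doubleton $\{s,t\}_D$). $u$ is a $D$-relation from $v$ to $P(v)$ if every $D$-element of $u$ is an ordered pair $\langle w,w'\rangle_D$ with $wEv$ and $w'\subset_D v$. $u$ is a $D$-function from $v$ to $P(v)$ if it is a $D$-relation from $v$ to $P(v)$ and for every $D$-element $w$ of $v$ there is exactly one ordered pair $\langle w,w'\rangle_D$ that is a $D$-element of $u$. $u$ is a $D$-surjection from $v$ to $P(v)$ if it is a $D$-function from $v$ to $P(v)$ and for every $w'\subset_D v$ there is at least one ordered pair $\langle w,w'\rangle_D$ that is a $D$-element of $u$. Cantor's theorem holds in $D$ ($D$ is Cantor) if for no vertex $u\in V$ there exists a vertex $v\in V$ that is a $D$-surjection from $u$ to $P(u)$. -}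

module Defs where

open import Data.List.Base using (List; []; _∷_; _++_; [_]; map; concatMap; filter)
open import Data.Nat.Base using (ℕ; zero; suc; NonZero; _<_; s≤s⁻¹)
open import Data.Nat.Properties as ℕ using (_<?_; <-≤-trans; n<1+n)
open import Data.Product using (_×_; _,_; ∃-syntax; ∃!)
open import Data.Product.Properties using (≡-dec)
open import Data.Sum.Base using (_⊎_)
open import Data.Vec.Base using (Vec; []; _∷_)
open import Data.Bool.Base using (if_then_else_)
open import Function.Bundles using (_⇔_)
open import Level using (Level) renaming (suc to lsuc)
open import Relation.Binary.Core using (Rel)
open import Relation.Binary.Definitions using (DecidableEquality)
open import Relation.Binary.PropositionalEquality using (_≡_; refl; sym; trans; cong)
open import Relation.Nullary using (¬_; does)
open import Relation.Nullary.Decidable using (True; toWitness; map′; ¬?)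
open import Relation.Unary using (_≐_; _⊆_; ｛_｝; _∪_) renaming (Pred to Subset)

private variable
  i j k m : ℕ
  ℓ : Level

------------------------------------------------------------------------
-- Letters and words

data Variable : Set where
  x[_] y[_]   : (i : ℕ) → .{{NonZero i}} → Variable
  x y z a b c : Variable

private
  code : Variable → ℕ × ℕ
  code x[ i ] = 0 , i
  code y[ i ] = 1 , i
  code x      = 2 , 0
  code y      = 3 , 0
  code z      = 4 , 0
  code a      = 5 , 0
  code b      = 6 , 0
  code c      = 7 , 0

  decode : ℕ × ℕ → Variable
  decode (0 , suc i) = x[ suc i ]
  decode (1 , suc i) = y[ suc i ]
  decode (2 , _)     = x
  decode (3 , _)     = y
  decode (4 , _)     = z
  decode (5 , _)     = a
  decode (6 , _)     = b
  decode (_ , _)     = c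

  decode-code : ∀ α → decode (code α) ≡ α
  decode-code x[ suc _ ] = refl
  decode-code y[ suc _ ] = refl
  decode-code x = refl
  decode-code y = refl
  decode-code z = refl
  decode-code a = refl
  decode-code b = refl
  decode-code c = refl

infix 4 _≟_
_≟_ : DecidableEquality Variable
α ≟ β = map′
  (λ eq → trans (sym (decode-code α)) (trans (cong decode eq) (decode-code β)))
  (cong code)
  (≡-dec ℕ._≟_ ℕ._≟_ (code α) (code β))

data Symbol : Set where
  `∈ `= `¬ `→ `↔ `∧ `∨ `∃ `∀ `⟨ `⟩ : Symbol

data Letter : Set where
  var : Variable → Letter
  sgn : Symbol → Letter

Word : Set
Word = List Letter

data In𝒜 : Letter → Set where
  var : ∀ i .{{_ : NonZero i}} → In𝒜 (var x[ i ])
  sgn : ∀ s → In𝒜 (sgn s)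

∣_∣¬ : Word → ℕ
∣ [] ∣¬         = 0
∣ sgn `¬ ∷ u ∣¬ = suc ∣ u ∣¬
∣ _ ∷ u ∣¬      = ∣ u ∣¬

replaceVar : Vec Variable m → Vec Variable m → Variable → Variable
replaceVar []       []       γ = γ
replaceVar (β ∷ βs) (α ∷ αs) γ = if does (γ ≟ β) then α else replaceVar βs αs γ

replaceLetter : Vec Variable m → Vec Variable m → Letter → Letter
replaceLetter βs αs (var γ) = var (replaceVar βs αs γ)
replaceLetter βs αs (sgn s) = sgn s

-- replace βs αs u puts αs for βs, simultaneously and at every occurrence.
replace : Vec Variable m → Vec Variable m → Word → Word
replace βs αs = map (replaceLetter βs αs)

-- The word operations are used both over Letter and over the larger
-- alphabets of the scheme below.
record HasLetters (A : Set) : Set where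
  field fromLetter : Letter → A

open HasLetters {{...}}

instance
  Letter-hasLetters : HasLetters Letter
  Letter-hasLetters = record { fromLetter = λ l → l }

module _ {A : Set} {{_ : HasLetters A}} where

  infix  30 _∈ʷ_ _=ʷ_
  infixr 20 _→ʷ_ _↔ʷ_ _∧ʷ_ _∨ʷ_
  infixr 25 ¬ʷ_ ∃ʷ[_]_ ∀ʷ[_]_

  private
    atomic : Variable → Symbol → Variable → List A
    atomic α s β = map fromLetter (sgn `⟨ ∷ var α ∷ sgn s ∷ var β ∷ sgn `⟩ ∷ [])

    binary : List A → Symbol → List A → List A
    binary u s v =
      [ fromLetter (sgn `⟨) ] ++ u ++ [ fromLetter (sgn s) ] ++ v ++ [ fromLetter (sgn `⟩) ]

    quantified : Symbol → (k : ℕ) → .{{NonZero k}} → List A → List A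
    quantified s k u =
      map fromLetter (sgn `⟨ ∷ sgn s ∷ var x[ k ] ∷ []) ++ u ++ [ fromLetter (sgn `⟩) ]

  _∈ʷ_ _=ʷ_ : Variable → Variable → List A
  α ∈ʷ β = atomic α `∈ β
  α =ʷ β = atomic α `= β

  ¬ʷ_ : List A → List A
  ¬ʷ u = fromLetter (sgn `¬) ∷ u

  _→ʷ_ _↔ʷ_ _∧ʷ_ _∨ʷ_ : List A → List A → List A
  u →ʷ v = binary u `→ v
  u ↔ʷ v = binary u `↔ v
  u ∧ʷ v = binary u `∧ v
  u ∨ʷ v = binary u `∨ v

  ∃ʷ[_]_ ∀ʷ[_]_ : (k : ℕ) → .{{NonZero k}} → List A → List A
  ∃ʷ[ k ] u = quantified `∃ k u
  ∀ʷ[ k ] u = quantified `∀ k u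

------------------------------------------------------------------------
-- Formulas

infix  30 _∈ᶠ_ _=ᶠ_
infixr 20 _→ᶠ_ _↔ᶠ_ _∧ᶠ_ _∨ᶠ_
infixr 25 ¬ᶠ_ ∃ᶠ[_]_ ∀ᶠ[_]_

-- A formula is kept as a syntax tree; the formula in the sense of words is its
-- image under word.  Only the x[ k ] can be quantified, not the new variables.
data Formula : Set where
  _∈ᶠ_ _=ᶠ_           : Variable → Variable → Formula
  ¬ᶠ_                 : Formula → Formula
  _→ᶠ_ _↔ᶠ_ _∧ᶠ_ _∨ᶠ_ : Formula → Formula → Formula
  ∃ᶠ[_]_ ∀ᶠ[_]_       : (k : ℕ) → .{{NonZero k}} → Formula → Formula

word : Formula → Word
word (α ∈ᶠ β)    = α ∈ʷ β
word (α =ᶠ β)    = α =ʷ β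
word (¬ᶠ F)      = ¬ʷ word F
word (F →ᶠ G)    = word F →ʷ word G
word (F ↔ᶠ G)    = word F ↔ʷ word G
word (F ∧ᶠ G)    = word F ∧ʷ word G
word (F ∨ᶠ G)    = word F ∨ʷ word G
word (∃ᶠ[ k ] F) = ∃ʷ[ k ] word F
word (∀ᶠ[ k ] F) = ∀ʷ[ k ] word F

freeVars : Formula → List Variable
freeVars (α ∈ᶠ β)    = α ∷ β ∷ []
freeVars (α =ᶠ β)    = α ∷ β ∷ []
freeVars (¬ᶠ F)      = freeVars F
freeVars (F →ᶠ G)    = freeVars F ++ freeVars G
freeVars (F ↔ᶠ G)    = freeVars F ++ freeVars G
freeVars (F ∧ᶠ G)    = freeVars F ++ freeVars G
freeVars (F ∨ᶠ G)    = freeVars F ++ freeVars G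
freeVars (∃ᶠ[ k ] F) = filter (λ α → ¬? (α ≟ x[ k ])) (freeVars F)
freeVars (∀ᶠ[ k ] F) = filter (λ α → ¬? (α ≟ x[ k ])) (freeVars F)

Sentence : Formula → Set
Sentence F = freeVars F ≡ []

------------------------------------------------------------------------
-- Digraphs and satisfaction

record Digraph ℓ : Set (lsuc ℓ) where
  field
    V        : Set ℓ
    E        : Rel V ℓ
    nonempty : V

module _ (D : Digraph ℓ) where
  open Digraph D

  _[_↦_] : (Variable → V) → Variable → V → (Variable → V)
  (f [ α ↦ d ]) β = if does (β ≟ α) then d else f β

  Sat : (Variable → V) → Formula → Set ℓ
  Sat f (α ∈ᶠ β)    = E (f α) (f β)
  Sat f (α =ᶠ β)    = f α ≡ f β
  Sat f (¬ᶠ F)      = ¬ Sat f F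
  Sat f (F →ᶠ G)    = Sat f F → Sat f G
  Sat f (F ↔ᶠ G)    = Sat f F ⇔ Sat f G
  Sat f (F ∧ᶠ G)    = Sat f F × Sat f G
  Sat f (F ∨ᶠ G)    = Sat f F ⊎ Sat f G
  Sat f (∃ᶠ[ k ] F) = ∃[ d ] Sat (f [ x[ k ] ↦ d ]) F
  Sat f (∀ᶠ[ k ] F) = ∀ d → Sat (f [ x[ k ] ↦ d ]) F

  -- The word u is a sentence, and it is true in D.  As the truth of a
  -- sentence does not depend on f, and V is nonempty, "for all f" and "for
  -- some f" are interchangeable here.
  infix 4 _⊨_
  _⊨_ : Word → Set ℓ
  _⊨_ u = ∃[ F ] word F ≡ u × Sentence F × (∀ f → Sat f F)

------------------------------------------------------------------------
-- The abbreviation scheme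

-- Predicate i m: the m-ary predicate introduced by the i-th shortcut.
data Predicate : ℕ → ℕ → Set where
  SUS : Predicate 1 2
  SI  : Predicate 2 2
  SIN : Predicate 3 2
  DO  : Predicate 4 3
  DOU : Predicate 5 3
  OPA : Predicate 6 3
  REL : Predicate 7 2
  FUN : Predicate 8 2
  SUR : Predicate 9 2

-- A letter, or an atom whose predicate belongs to a shortcut before the i-th.
data Item (i : ℕ) : Set where
  letter : Letter → Item i
  atom   : Predicate k m → k < i → Vec Variable m → Item i

instance
  Item-hasLetters : HasLetters (Item i)
  Item-hasLetters = record { fromLetter = letter }

infix 30 _⟦_⟧
_⟦_⟧ : Predicate k m → {True (k <? i)} → Vec Variable m → List (Item i)
_⟦_⟧ q {k<i} αs = [ atom q (toWitness k<i) αs ]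

leftArgs : Predicate i m → Vec Variable m
leftArgs SUS = x ∷ y ∷ []
leftArgs SI  = x ∷ y ∷ []
leftArgs SIN = x ∷ y ∷ []
leftArgs DO  = x ∷ y ∷ z ∷ []
leftArgs DOU = x ∷ y ∷ z ∷ []
leftArgs OPA = x ∷ y ∷ z ∷ []
leftArgs REL = x ∷ y ∷ []
leftArgs FUN = x ∷ y ∷ []
leftArgs SUR = x ∷ y ∷ []

rhs : Predicate i m → List (Item i)
rhs SUS = ∀ʷ[ 1 ] (x[ 1 ] ∈ʷ x →ʷ x[ 1 ] ∈ʷ y)
rhs SI  = ∀ʷ[ 2 ] (x[ 2 ] ∈ʷ x ↔ʷ x[ 2 ] =ʷ y)
rhs SIN = ∀ʷ[ 3 ] (SI ⟦ x[ 3 ] ∷ y ∷ [] ⟧ ↔ʷ x[ 3 ] =ʷ x)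
rhs DO  = ∀ʷ[ 4 ] (x[ 4 ] ∈ʷ x ↔ʷ (x[ 4 ] =ʷ y ∨ʷ x[ 4 ] =ʷ z))
rhs DOU = ∀ʷ[ 5 ] (DO ⟦ x[ 5 ] ∷ y ∷ z ∷ [] ⟧ ↔ʷ x[ 5 ] =ʷ x)
rhs OPA = ∃ʷ[ 6 ] ∃ʷ[ 7 ]
  (DOU ⟦ x ∷ x[ 6 ] ∷ x[ 7 ] ∷ [] ⟧ ∧ʷ
   (SIN ⟦ x[ 6 ] ∷ y ∷ [] ⟧ ∧ʷ DOU ⟦ x[ 7 ] ∷ y ∷ z ∷ [] ⟧))
rhs REL = ∀ʷ[ 8 ]
  (x[ 8 ] ∈ʷ x →ʷ
   ∃ʷ[ 9 ] ∃ʷ[ 10 ]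
     (OPA ⟦ x[ 8 ] ∷ x[ 9 ] ∷ x[ 10 ] ∷ [] ⟧ ∧ʷ
      (x[ 9 ] ∈ʷ y ∧ʷ SUS ⟦ x[ 10 ] ∷ y ∷ [] ⟧)))
rhs FUN =
  REL ⟦ x ∷ y ∷ [] ⟧ ∧ʷ
  ∀ʷ[ 11 ]
    (x[ 11 ] ∈ʷ y →ʷ
     ∃ʷ[ 12 ] ∀ʷ[ 13 ]
       (x[ 13 ] =ʷ x[ 12 ] ↔ʷ
        (x[ 13 ] ∈ʷ x ∧ʷ ∃ʷ[ 14 ] OPA ⟦ x[ 13 ] ∷ x[ 11 ] ∷ x[ 14 ] ∷ [] ⟧)))
rhs SUR =
  FUN ⟦ x ∷ y ∷ [] ⟧ ∧ʷ
  ∀ʷ[ 15 ]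
    (SUS ⟦ x[ 15 ] ∷ y ∷ [] ⟧ →ʷ
     ∃ʷ[ 16 ] ∃ʷ[ 17 ]
       (x[ 16 ] ∈ʷ x ∧ʷ OPA ⟦ x[ 16 ] ∷ x[ 17 ] ∷ x[ 15 ] ∷ [] ⟧))

-- The bound n only serves the termination checker.
expandBelow : ∀ n → Predicate i m → i < n → Word
expandBelow {i} (suc n) q i<1+n = concatMap expandItem (rhs q)
  where
  expandItem : Item i → Word
  expandItem (letter l)      = [ l ]
  expandItem (atom p k<i αs) =
    replace (leftArgs p) αs (expandBelow n p (<-≤-trans k<i (s≤s⁻¹ i<1+n)))

expansion : Predicate i m → Word
expansion {i} q = expandBelow (suc i) q (n<1+n i)

E₉ : Word
E₉ = expansion SUR

φ : Word
φ = ∀ʷ[ 18 ] ¬ʷ ∃ʷ[ 19 ] replace (x ∷ y ∷ []) (x[ 19 ] ∷ x[ 18 ] ∷ []) E₉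

------------------------------------------------------------------------
-- Cantor's theorem in a digraph

module _ (D : Digraph ℓ) where
  open Digraph D

  N : V → Subset V ℓ
  N u v = E v u

  IsSubset : V → V → Set ℓ
  IsSubset u v = N u ⊆ N v

  IsSingleton : V → V → Set ℓ
  IsSingleton u v =
    N u ≐ ｛ v ｝ × (∀ u′ → N u′ ≐ ｛ v ｝ → u′ ≡ u)

  IsDoubleton : V → V → V → Set ℓ
  IsDoubleton u v w =
    N u ≐ ｛ v ｝ ∪ ｛ w ｝ × (∀ u′ → N u′ ≐ ｛ v ｝ ∪ ｛ w ｝ → u′ ≡ u)

  IsOrderedPair : V → V → V → Set ℓ
  IsOrderedPair u v w =
    ∃[ s ] ∃[ t ] IsSingleton s v × IsDoubleton t v w × IsDoubleton u s t

  -- The vertex u as a relation, function or surjection from v to P(v).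
  IsRelation : V → V → Set ℓ
  IsRelation u v =
    ∀ p → E p u → ∃[ w ] ∃[ w′ ] IsOrderedPair p w w′ × E w v × IsSubset w′ v

  IsFunction : V → V → Set ℓ
  IsFunction u v =
    IsRelation u v ×
    (∀ w → E w v → ∃! _≡_ λ p → E p u × ∃[ w′ ] IsOrderedPair p w w′)

  IsSurjection : V → V → Set ℓ
  IsSurjection u v =
    IsFunction u v ×
    (∀ w′ → IsSubset w′ v → ∃[ p ] E p u × ∃[ w ] IsOrderedPair p w w′)

  Cantor : Set ℓ
  Cantor = ∀ u → ¬ (∃[ v ] IsSurjection v u)

{-# OPTIONS --safe #-}

-- Formulas are recovered from their words by a shift-reduce parser, so the
-- only formula whose word is φ is the syntax tree φᶠ of the expansion.  No
-- variable is captured in the expansion: the arguments of an atom are new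
-- variables or have a greater index than those bound in the atom's expansion.
-- Hence satisfaction of φᶠ is definitionally the formula read over V, and it
-- is compared with the definitions for digraphs one shortcut at a time.
module Submission where

open import Data.List.Base using (List; []; _∷_; _++_; length)
open import Data.List.Properties using (++-assoc; ++-identityʳ)
open import Data.List.Relation.Unary.All using (All; all?)
open import Data.Maybe.Base using (Maybe; just; nothing)
open import Data.Maybe.Properties using (just-injective)
open import Data.Nat.Base using (nonZero)
open import Data.Product using (_×_; _,_; ∃-syntax; ∃!)
open import Data.Product.Function.NonDependent.Propositional using (_×-⇔_)
open import Data.Sum.Base using (_⊎_)
open import Data.Sum.Function.Propositional using (_⊎-⇔_)
open import Function.Base using (_∘_)
open import Function.Bundles using (_⇔_; mk⇔; Equivalence)
open import Function.Construct.Identity using (⇔-id)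
open import Function.Related.TypeIsomorphisms using (→-cong-⇔; ¬-cong-⇔)
open import Level using (Level)
open import Relation.Binary.PropositionalEquality
  using (_≡_; refl; sym; trans; cong; subst; module ≡-Reasoning)
open import Relation.Nullary using (yes; no)
open import Relation.Nullary.Decidable using (toWitness)
open import Relation.Unary using (_≐_; Decidable) renaming (Pred to Subset)
open import Defs

open Equivalence using (to; from)

data Token : Set where
  letter  : Letter → Token
  formula : Formula → Token

Stack : Set
Stack = List Token

pattern ⌊_⌋ s = letter (sgn s)
pattern ⌈_⌉ α = letter (var α)

-- A negation has no closing bracket to mark the end of its scope, so pending negations are absorbed
-- as soon as their operand is complete.
push : Formula → Stack → Stack
push F (⌊ `¬ ⌋ ∷ σ) = push (¬ᶠ F) σ
push F σ            = formula F ∷ σ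

-- Stacks list the latest token first; ill-formed ones are left as they are.
close : Stack → Stack
close (⌈ β ⌉ ∷ ⌊ `∈ ⌋ ∷ ⌈ α ⌉ ∷ ⌊ `⟨ ⌋ ∷ σ)             = push (α ∈ᶠ β) σ
close (⌈ β ⌉ ∷ ⌊ `= ⌋ ∷ ⌈ α ⌉ ∷ ⌊ `⟨ ⌋ ∷ σ)             = push (α =ᶠ β) σ
close (formula G ∷ ⌊ `→ ⌋ ∷ formula F ∷ ⌊ `⟨ ⌋ ∷ σ)     = push (F →ᶠ G) σ
close (formula G ∷ ⌊ `↔ ⌋ ∷ formula F ∷ ⌊ `⟨ ⌋ ∷ σ)     = push (F ↔ᶠ G) σ
close (formula G ∷ ⌊ `∧ ⌋ ∷ formula F ∷ ⌊ `⟨ ⌋ ∷ σ)     = push (F ∧ᶠ G) σ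
close (formula G ∷ ⌊ `∨ ⌋ ∷ formula F ∷ ⌊ `⟨ ⌋ ∷ σ)     = push (F ∨ᶠ G) σ
close (formula F ∷ ⌈ x[ k ] ⌉ ∷ ⌊ `∃ ⌋ ∷ ⌊ `⟨ ⌋ ∷ σ)    = push (∃ᶠ[ k ] F) σ
close (formula F ∷ ⌈ x[ k ] ⌉ ∷ ⌊ `∀ ⌋ ∷ ⌊ `⟨ ⌋ ∷ σ)    = push (∀ᶠ[ k ] F) σ
close σ                                                 = σ

run : Stack → Word → Stack
run σ []           = σ
run σ (sgn `⟩ ∷ u) = run (close σ) u
run σ (l ∷ u)      = run (letter l ∷ σ) u

result : Stack → Maybe Formula
result (formula F ∷ []) = just F
result _                = nothing

module _ where
  open ≡-Reasoning

  -- Induction on `F` needs an arbitrary stack and an arbitrary remaining word, since a subformula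
  -- is read in the midst of a larger one.
  run-word : ∀ F σ u → run σ (word F ++ u) ≡ run (push F σ) u

  -- The opening bracket on top of the stack keeps `push` from absorbing anything. The lemma stops
  -- before `l`, because `run` shifts a letter only once it is known not to be a closing bracket.
  run-binary : ∀ F l G σ u →
    run σ ((sgn `⟨ ∷ word F ++ l ∷ word G ++ sgn `⟩ ∷ []) ++ u) ≡
    run (formula F ∷ ⌊ `⟨ ⌋ ∷ σ) (l ∷ word G ++ sgn `⟩ ∷ u)
  run-binary F l G σ u = begin
    run σ′ ((word F ++ l ∷ word G ++ sgn `⟩ ∷ []) ++ u)
      ≡⟨ cong (run σ′) (++-assoc (word F) _ u) ⟩
    run σ′ (word F ++ l ∷ (word G ++ sgn `⟩ ∷ []) ++ u)
      ≡⟨ run-word F σ′ _ ⟩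
    run (formula F ∷ σ′) (l ∷ (word G ++ sgn `⟩ ∷ []) ++ u)
      ≡⟨ cong (λ v → run (formula F ∷ σ′) (l ∷ v)) (++-assoc (word G) _ u) ⟩
    run (formula F ∷ σ′) (l ∷ word G ++ sgn `⟩ ∷ u) ∎
    where σ′ = ⌊ `⟨ ⌋ ∷ σ

  run-closed : ∀ F σ u →
    run σ ((word F ++ sgn `⟩ ∷ []) ++ u) ≡ run (push F σ) (sgn `⟩ ∷ u)
  run-closed F σ u =
    trans (cong (run σ) (++-assoc (word F) _ u)) (run-word F σ _)

  run-word (α ∈ᶠ β) σ u = refl
  run-word (α =ᶠ β) σ u = refl
  -- `push F` on a stack topped by the negation is by definition `push (¬ᶠ F) σ`.
  run-word (¬ᶠ F) σ u = run-word F (⌊ `¬ ⌋ ∷ σ) u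
  run-word (F →ᶠ G) σ u = trans (run-binary F _ G σ u) (run-word G _ _)
  run-word (F ↔ᶠ G) σ u = trans (run-binary F _ G σ u) (run-word G _ _)
  run-word (F ∧ᶠ G) σ u = trans (run-binary F _ G σ u) (run-word G _ _)
  run-word (F ∨ᶠ G) σ u = trans (run-binary F _ G σ u) (run-word G _ _)
  run-word (∃ᶠ[ k ] F) σ u = run-closed F _ u
  run-word (∀ᶠ[ k ] F) σ u = run-closed F _ u

  result-run-word : ∀ F → result (run [] (word F)) ≡ just F
  result-run-word F = begin
    result (run [] (word F))       ≡⟨ cong (result ∘ run []) (++-identityʳ (word F)) ⟨
    result (run [] (word F ++ [])) ≡⟨ cong result (run-word F [] []) ⟩
    just F                         ∎

word-injective : ∀ F G → word F ≡ word G → F ≡ G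
word-injective F G eq = just-injective (trans (sym (result-run-word F))
  (trans (cong (result ∘ run []) eq) (result-run-word G)))

-- The arguments of a predicate are parameters here, so replacement in an expansion becomes plain
-- application.
SUSᶠ SIᶠ SINᶠ RELᶠ FUNᶠ SURᶠ : Variable → Variable → Formula
DOᶠ DOUᶠ OPAᶠ                : Variable → Variable → Variable → Formula

SUSᶠ α β   = ∀ᶠ[ 1 ] (x[ 1 ] ∈ᶠ α →ᶠ x[ 1 ] ∈ᶠ β)
SIᶠ  α β   = ∀ᶠ[ 2 ] (x[ 2 ] ∈ᶠ α ↔ᶠ x[ 2 ] =ᶠ β)
SINᶠ α β   = ∀ᶠ[ 3 ] (SIᶠ x[ 3 ] β ↔ᶠ x[ 3 ] =ᶠ α)
DOᶠ  α β γ = ∀ᶠ[ 4 ] (x[ 4 ] ∈ᶠ α ↔ᶠ (x[ 4 ] =ᶠ β ∨ᶠ x[ 4 ] =ᶠ γ))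
DOUᶠ α β γ = ∀ᶠ[ 5 ] (DOᶠ x[ 5 ] β γ ↔ᶠ x[ 5 ] =ᶠ α)
OPAᶠ α β γ = ∃ᶠ[ 6 ] ∃ᶠ[ 7 ]
  (DOUᶠ α x[ 6 ] x[ 7 ] ∧ᶠ (SINᶠ x[ 6 ] β ∧ᶠ DOUᶠ x[ 7 ] β γ))
RELᶠ α β   = ∀ᶠ[ 8 ]
  (x[ 8 ] ∈ᶠ α →ᶠ
   ∃ᶠ[ 9 ] ∃ᶠ[ 10 ] (OPAᶠ x[ 8 ] x[ 9 ] x[ 10 ] ∧ᶠ (x[ 9 ] ∈ᶠ β ∧ᶠ SUSᶠ x[ 10 ] β)))
FUNᶠ α β   = RELᶠ α β ∧ᶠ
  ∀ᶠ[ 11 ]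
    (x[ 11 ] ∈ᶠ β →ᶠ
     ∃ᶠ[ 12 ] ∀ᶠ[ 13 ]
       (x[ 13 ] =ᶠ x[ 12 ] ↔ᶠ (x[ 13 ] ∈ᶠ α ∧ᶠ ∃ᶠ[ 14 ] OPAᶠ x[ 13 ] x[ 11 ] x[ 14 ])))
SURᶠ α β   = FUNᶠ α β ∧ᶠ
  ∀ᶠ[ 15 ]
    (SUSᶠ x[ 15 ] β →ᶠ
     ∃ᶠ[ 16 ] ∃ᶠ[ 17 ] (x[ 16 ] ∈ᶠ α ∧ᶠ OPAᶠ x[ 16 ] x[ 17 ] x[ 15 ]))

φᶠ : Formula
φᶠ = ∀ᶠ[ 18 ] ¬ᶠ ∃ᶠ[ 19 ] SURᶠ x[ 19 ] x[ 18 ]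

word-φᶠ : word φᶠ ≡ φ
word-φᶠ = refl

-- Lets the claim about all letters of `φ` be settled by evaluation.
In𝒜? : Decidable In𝒜
In𝒜? (var x[ i ]) = yes (var i)
In𝒜? (var y[ i ]) = no λ ()
In𝒜? (var x)      = no λ ()
In𝒜? (var y)      = no λ ()
In𝒜? (var z)      = no λ ()
In𝒜? (var a)      = no λ ()
In𝒜? (var b)      = no λ ()
In𝒜? (var c)      = no λ ()
In𝒜? (sgn s)      = yes (sgn s)

private variable
  p q r ℓ : Level

-- The formulas put the bound variable on the left of an equation, whereas membership of `e` in
-- `｛ v ｝` unfolds to `v ≡ e`.
≡-swap : {A : Set p} {v w : A} → v ≡ w ⇔ w ≡ v
≡-swap = mk⇔ sym sym

Π-⇔ : {A : Set p} {P : A → Set q} {Q : A → Set r} →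
      (∀ e → P e ⇔ Q e) → (∀ e → P e) ⇔ (∀ e → Q e)
Π-⇔ P⇔Q = mk⇔ (λ g e → to (P⇔Q e) (g e)) (λ g e → from (P⇔Q e) (g e))

∃-⇔ : {A : Set p} {P : A → Set q} {Q : A → Set r} →
      (∀ e → P e ⇔ Q e) → (∃[ e ] P e) ⇔ (∃[ e ] Q e)
∃-⇔ P⇔Q = mk⇔ (λ (e , h) → e , to (P⇔Q e) h) (λ (e , h) → e , from (P⇔Q e) h)

-- The left side is how `FUN` expresses unique existence: its direction from `e ≡ d` gives existence
-- at `refl`, the other one uniqueness.
∃!-⇔ : {A : Set p} {P : A → Set q} {Q : A → Set r} →
       (∀ e → P e ⇔ Q e) → (∃[ d ] ∀ e → e ≡ d ⇔ P e) ⇔ ∃! _≡_ Q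
∃!-⇔ P⇔Q = mk⇔
  (λ (d , h) → d , to (P⇔Q d) (to (h d) refl) , λ {e} Qe → sym (from (h e) (from (P⇔Q e) Qe)))
  (λ (d , Qd , unique) → d , λ e →
    mk⇔ (λ { refl → from (P⇔Q e) Qd }) (λ Pe → sym (unique (to (P⇔Q e) Pe))))

module _ (D : Digraph ℓ) where
  open Digraph D

  private variable
    P Q   : Subset V ℓ
    u v w : V

  N-≐ : (∀ e → P e ⇔ Q e) → (∀ e → E e u ⇔ P e) ⇔ N D u ≐ Q
  N-≐ P⇔Q = mk⇔
    (λ h → (λ {e} Eeu → to (P⇔Q e) (to (h e) Eeu)) , (λ {e} Qe → from (h e) (from (P⇔Q e) Qe)))
    (λ (N⊆Q , Q⊆N) e → mk⇔ (λ Eeu → from (P⇔Q e) (N⊆Q Eeu)) (λ Pe → Q⊆N (to (P⇔Q e) Pe)))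

  -- The common shape of `SIN` and `DOU`.
  only-vertex : (∀ e → P e ⇔ Q e) →
    (∀ d → (∀ e → E e d ⇔ P e) ⇔ d ≡ u) ⇔
    (N D u ≐ Q × (∀ u′ → N D u′ ≐ Q → u′ ≡ u))
  only-vertex {u = u} P⇔Q = mk⇔
    -- Taking `d` to be `u` itself, `refl` shows that `u` has the required elements.
    (λ h → to (N-≐ P⇔Q) (from (h u) refl) , λ u′ N≐Q → to (h u′) (from (N-≐ P⇔Q) N≐Q))
    (λ (N≐Q , unique) d →
      mk⇔ (λ h → unique d (to (N-≐ P⇔Q) h)) (λ { refl → from (N-≐ P⇔Q) N≐Q }))

  subset-⇔ : (∀ e → E e u → E e v) ⇔ IsSubset D u v
  subset-⇔ = mk⇔ (λ h {e} → h e) (λ h e → h {e})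

  singleton-⇔ : (∀ d → (∀ e → E e d ⇔ e ≡ v) ⇔ d ≡ u) ⇔ IsSingleton D u v
  singleton-⇔ = only-vertex λ _ → ≡-swap

  doubleton-⇔ : (∀ d → (∀ e → E e d ⇔ (e ≡ v ⊎ e ≡ w)) ⇔ d ≡ u) ⇔ IsDoubleton D u v w
  doubleton-⇔ = only-vertex λ _ → ≡-swap ⊎-⇔ ≡-swap

  orderedPair-⇔ : ∀ f → Sat D f (OPAᶠ x y z) ⇔ IsOrderedPair D (f x) (f y) (f z)
  orderedPair-⇔ f = ∃-⇔ λ s → ∃-⇔ λ t → mk⇔
    (λ (u≡st , s≡v , t≡vw) → to singleton-⇔ s≡v , to doubleton-⇔ t≡vw , to doubleton-⇔ u≡st)
    (λ (s≡v , t≡vw , u≡st) → from doubleton-⇔ u≡st , from singleton-⇔ s≡v , from doubleton-⇔ t≡vw)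

  private
    -- Gives `x`, `y`, `z` the values of an atom's arguments. Satisfaction of the atom unfolds to a
    -- statement about these values, so the lemmas stated for `x`, `y`, `z` apply to it.
    ⟨_,_,_⟩ : V → V → V → Variable → V
    ⟨ u , v , w ⟩ x = u
    ⟨ u , v , w ⟩ y = v
    ⟨ u , v , w ⟩ _ = w

  relation-⇔ : ∀ f → Sat D f (RELᶠ x y) ⇔ IsRelation D (f x) (f y)
  relation-⇔ f = Π-⇔ λ p → →-cong-⇔ (⇔-id _) (∃-⇔ λ w → ∃-⇔ λ w′ →
    orderedPair-⇔ ⟨ p , w , w′ ⟩ ×-⇔ (⇔-id _ ×-⇔ subset-⇔))

  function-⇔ : ∀ f → Sat D f (FUNᶠ x y) ⇔ IsFunction D (f x) (f y)
  function-⇔ f = relation-⇔ f ×-⇔ Π-⇔ λ w → →-cong-⇔ (⇔-id _) (∃!-⇔ λ p →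
    ⇔-id _ ×-⇔ ∃-⇔ λ w′ → orderedPair-⇔ ⟨ p , w , w′ ⟩)

  surjection-⇔ : ∀ f → Sat D f (SURᶠ x y) ⇔ IsSurjection D (f x) (f y)
  surjection-⇔ f = function-⇔ f ×-⇔ Π-⇔ λ w′ → →-cong-⇔ subset-⇔ (∃-⇔ λ p →
    mk⇔ (λ (w , Epu , pair) → Epu , w , to (orderedPair-⇔ ⟨ p , w , w′ ⟩) pair)
        (λ (Epu , w , pair) → w , Epu , from (orderedPair-⇔ ⟨ p , w , w′ ⟩) pair))

  φᶠ-⇔ : ∀ f → Sat D f φᶠ ⇔ Cantor D
  -- As `z` does not occur in `SURᶠ x y`, the third entry is an arbitrary filler.
  φᶠ-⇔ f = Π-⇔ λ u → ¬-cong-⇔ (∃-⇔ λ v → surjection-⇔ ⟨ v , u , u ⟩)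

  ⊨φ⇔Cantor : D ⊨ φ ⇔ Cantor D
  ⊨φ⇔Cantor = mk⇔
    (λ (F , word-F , _ , true) →
      -- Truth under all assignments yields Cantor's theorem only through some assignment; a
      -- constant one exists since `V` is nonempty.
      let f = λ _ → nonempty
          F≡φᶠ = word-injective F φᶠ (trans word-F (sym word-φᶠ))
      in to (φᶠ-⇔ f) (subst (Sat D f) F≡φᶠ (true f)))
    -- Here `refl` computes that `φᶠ` has no free variables.
    (λ cantor → φᶠ , word-φᶠ , refl , λ f → from (φᶠ-⇔ f) cantor)

theorem5p12 : (ℓ : Level) →
    All In𝒜 φ ×
    length φ ≡ 494 ×
    ∣ φ ∣¬ ≡ 1 ×
    ((D : Digraph ℓ) → (D ⊨ φ) ⇔ Cantor D)
theorem5p12 ℓ = toWitness {a? = all? In𝒜? φ} _ , refl , refl , ⊨φ⇔Cantor
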